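{- For all Conway's games $x,y$, $$x\approx y\iff x\sim y .$$
   Context: Hypergames: work in a universe of possibly non-wellfounded sets (set theory with the Antifoundation Axiom, and the Axiom of Choice). The class $\mathcal H$ of hypergames (also called games) is the carrier of the final coalgebra $(\mathcal H,\mathrm{id})$ of the functor $F(A)=\mathcal P(A)\times\mathcal P(A)$ on the category of classes and functional classes, where $\mathcal P$ is the powerset functor. Thus a hypergame is a pair $x=(X^L,X^R)$ of sets of hypergames; elements $x^L\in X^L$ and $x^R\in X^R$ are the Left and Right options of $x$. Positions of $x$ are the hypergames hereditarily reachable from $x$. $0=(\emptyset,\emptyset)$. Conway's games are the well-founded hypergames, i.e. the elements of the carrier $\mathcal G$ of the initial algebra of $F$: inductively, if $X,X'\subseteq\mathcal G$ are sets then $(X,X')\in\mathcal G$. On Conway's games, define by induction $x\gtrsim y$ iff for all $x^R\in X^R$, $y\not\gtrsim x^R$, and for all $y^L\in Y^L$, $y^L\not\gtrsim x$. Define $x\sim y$ iff $x\gtrsim y$ and $y\gtrsim x$. Sum (on hypergames, defined coinductively): $x+y=(\{x^L+y\mid x^L\in X^L\}\cup\{x+y^L\mid y^L\in Y^L\},\ \{x^R+y\mid x^R\in X^R\}\cup\{x+y^R\mid y^R\in Y^R\})$. Plays: L (Left) and R (Right) move alternately; either may start. Player I is the one who starts, player II the other one; LI means L acting as player I, and similarly LII, RI, RII. A play on $x$ is a (possibly empty) finite or infinite sequence $x_1^{K_1}x_2^{K_2}\cdots$ with $K_i\in\{L,R\}$ and $K_{i+1}\neq K_i$, such that, with $x_0=x$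 and $x_i=(X_i^L,X_i^R)$, one has $x_{i+1}\in X_i^{K_{i+1}}$ for all $i\ge 0$. A finite play is winning for L (resp. R) if it ends with a position $y=(Y^L,Y^R)$ where R (resp. L) is next to move but $Y^R=\emptyset$ (resp. $Y^L=\emptyset$); the empty play ends at $x$ with the starting player next to move. Every infinite play is a draw. A play is non-losing for L (resp. R) if it is winning for L (resp. R) or is a draw. Strategies: for P in $\{$LI, LII, RI, RII$\}$ let $\mathrm{FPlay}^P_x$ be the set of finite plays on $x$ in which P has the prescribed role (first or second player) and is next to move (the empty play is included exactly when P is LI or RI). A strategy for P on $x$ is a partial function $f$ from $\mathrm{FPlay}^P_x$ to positions of $x$ such that $f(\pi)=x'$ implies that $\pi x'$ is a play, and $f(\pi)$ is defined whenever some $\pi x'$ is a play. The opponent of LI is RII, and of LII is RI (and conversely). A play $\pi$ is coherent with $f$ if for each proper prefix $\pi'$ of $\pi$ where P is next to move, $f(\pi')=x'$ implies $\pi'x'$ is a prefix of $\pi$. For a strategy $f$ for P and a strategy $f'$ for the opponent, $f*f'$ is the unique maximal play coherent with both. $f$ is non-losing for P if $f*f'$ is non-losing for P (i.e. for L or R accordingly) for every strategy $f'$ of the opponent. A strategy for L is a pair of strategies for LI and LII; for R, for RI and RII; for I, for LI and RI; for II, for LII and RII. Such a pair is non-losing if both components are. Equideterminacy: $x\Updownarrow y$ iff, for each player P in $\{$L, R, I, II$\}$, $x$ has a non-losing strategy for P if and only if $y$ does. Contextual equivalence: additive contexts are $C[\ ]::=[\ ]\mid C[\ ]+z\mid z+C[\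 ]$ with $z$ any hypergame; $x\approx y$ iff $C[x]\Updownarrow C[y]$ for every additive context $C[\ ]$. -}

module Defs where

open import Data.Empty.Polymorphic using (⊥)
open import Data.List.Base using (List; []; _∷_; _∷ʳ_; applyUpTo; length)
import Data.List.Relation.Binary.Pointwise as List
open import Data.List.Relation.Binary.Prefix.Heterogeneous using (Prefix)
open import Data.Maybe.Base using (Maybe; just)
import Data.Maybe.Relation.Binary.Pointwise as Maybe
open import Data.Nat.Base using (ℕ)
open import Data.Product.Base using (∃; Σ; _×_; _,_)
open import Data.Sum.Base using (_⊎_)
open import Data.Unit.Polymorphic using (⊤)
open import Function.Bundles using (Func; _⇔_)
open import Induction.WellFounded using (Acc; acc)
open import Level using (Level; suc)
open import Relation.Binary.Bundles using (Setoid)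
open import Relation.Binary.Core using (REL; Rel)
open import Relation.Binary.Definitions using (_Respectsˡ_; _Respectsʳ_)
open import Relation.Binary.PropositionalEquality.Core using (_≡_)
open import Relation.Nullary.Negation.Core using (¬_)
open import Relation.Unary using (Pred; Empty)

private
  variable
    ℓ : Level

-- The axiom of choice of set theory: a total relation between sets contains
-- a function.  Sets being setoids here, the chosen function has to respect
-- equality; without that clause the axiom would be provable outright.
AxiomOfChoice : ∀ ℓ → Set (suc (suc ℓ))
AxiomOfChoice ℓ =
  (A B : Setoid ℓ (suc ℓ)) →
  let module A = Setoid A
      module B = Setoid B
  in
  (R : REL A.Carrier B.Carrier (suc ℓ)) →
  R Respectsˡ A._≈_ → R Respectsʳ B._≈_ →
  (∀ a → ∃ λ b → R a b) →
  Σ (Func A B) λ f → ∀ a → R a (Func.to f a)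

data Side : Set where
  L R : Side

op : Side → Side
op L = R
op R = L

-- Under the Antifoundation Axiom every small coalgebra A → 𝒫 A × 𝒫 A has
-- exactly one decoration by hypergames, and every hypergame is the value of
-- such a decoration at some point.  So a hypergame is given by a pointed
-- coalgebra, and two of these denote the same hypergame iff their points are
-- bisimilar: the equality of hypergames is _≋_ below, not _≡_.
record Hypergame ℓ : Set (suc ℓ) where
  field
    Node    : Set ℓ
    Options : Side → Node → Pred Node ℓ
    root    : Node

open Hypergame public

infixl 8 _at_
_at_ : (x : Hypergame ℓ) → Node x → Hypergame ℓ
x at a = record { Node = Node x ; Options = Options x ; root = a }

record IsBisimulation (x y : Hypergame ℓ) (Z : REL (Node x) (Node y) ℓ) : Set ℓ where
  field
    forth : ∀ {a b} → Z a b → ∀ K a′ → Options x K a a′ →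
            ∃ λ b′ → Options y K b b′ × Z a′ b′
    back  : ∀ {a b} → Z a b → ∀ K b′ → Options y K b b′ →
            ∃ λ a′ → Options x K a a′ × Z a′ b′

infix 4 _≋_
_≋_ : Rel (Hypergame ℓ) (suc ℓ)
_≋_ {ℓ} x y = ∃ λ (Z : REL (Node x) (Node y) ℓ) → IsBisimulation x y Z × Z (root x) (root y)

infix 4 _∈[_]_
_∈[_]_ : Hypergame ℓ → Side → Hypergame ℓ → Set (suc ℓ)
y ∈[ K ] x = ∃ λ a → Options x K (root x) a × x at a ≋ y

NoOptions : Side → Hypergame ℓ → Set ℓ
NoOptions K x = Empty (Options x K (root x))

-- The node (a , b) of x + y denotes (x at a) + (y at b).
infixl 6 _+_
_+_ : Hypergame ℓ → Hypergame ℓ → Hypergame ℓ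
x + y = record
  { Node    = Node x × Node y
  ; Options = λ { K (a , b) (a′ , b′) →
                    (Options x K a a′ × b ≡ b′) ⊎ (a ≡ a′ × Options y K b b′) }
  ; root    = root x , root y
  }

IsOption : (x : Hypergame ℓ) → Rel (Node x) ℓ
IsOption x a′ a = ∃ λ K → Options x K a a′

record ConwayGame ℓ : Set (suc ℓ) where
  field
    hypergame   : Hypergame ℓ
    wellFounded : Acc (IsOption hypergame) (root hypergame)

open ConwayGame public

-- For a node a of x and a node b of y, both accessible: x at a ≳ y at b.
geq : (x y : Hypergame ℓ) {a : Node x} {b : Node y} →
      Acc (IsOption x) a → Acc (IsOption y) b → Set ℓ
geq x y {a} {b} (acc p) (acc q) =
  (∀ a′ (o : Options x R a a′) → ¬ geq y x (acc q) (p (R , o))) ×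
  (∀ b′ (o : Options y L b b′) → ¬ geq y x (q (L , o)) (acc p))

infix 4 _≳_ _∼_
_≳_ : Rel (ConwayGame ℓ) ℓ
x ≳ y = geq (hypergame x) (hypergame y) (wellFounded x) (wellFounded y)

_∼_ : Rel (ConwayGame ℓ) ℓ
x ∼ y = x ≳ y × y ≳ x

-- A play is recorded together with the side s that starts; the labels
-- K₁ K₂ … are then s , op s , s , … and are left out.

turn : Side → List (Hypergame ℓ) → Side
turn s []      = s
turn s (_ ∷ π) = turn (op s) π

end : Hypergame ℓ → List (Hypergame ℓ) → Hypergame ℓ
end x []      = x
end x (y ∷ π) = end y π

data IsPlay {ℓ} : Side → Hypergame ℓ → List (Hypergame ℓ) → Set (suc ℓ) where
  []  : ∀ {s x} → IsPlay s x []
  _∷_ : ∀ {s x y π} → y ∈[ s ] x → IsPlay (op s) y π → IsPlay s x (y ∷ π)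

data Play {ℓ} (s : Side) (x : Hypergame ℓ) : Set (suc ℓ) where
  finite   : (π : List (Hypergame ℓ)) → IsPlay s x π → Play s x
  infinite : (σ : ℕ → Hypergame ℓ) → (∀ n → IsPlay s x (applyUpTo σ n)) → Play s x

module _ {s : Side} {x : Hypergame ℓ} where

  infix 4 _⊑_ _⊏_ _≼_

  _⊑_ : List (Hypergame ℓ) → Play s x → Set (suc ℓ)
  π ⊑ finite ρ _   = Prefix _≋_ π ρ
  π ⊑ infinite σ _ = Prefix _≋_ π (applyUpTo σ (length π))

  _⊏_ : List (Hypergame ℓ) → Play s x → Set (suc ℓ)
  π ⊏ p = ∃ λ y → π ∷ʳ y ⊑ p

  -- The prefix order between possibly infinite plays.
  _≼_ : Rel (Play s x) (suc ℓ)
  p ≼ q = ∀ π → π ⊑ p → π ⊑ q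

  Winning : Side → Play s x → Set ℓ
  Winning K (finite π _)   = turn s π ≡ op K × NoOptions (op K) (end x π)
  Winning K (infinite _ _) = ⊥

  Draw : Play s x → Set ℓ
  Draw (finite _ _)   = ⊥
  Draw (infinite _ _) = ⊤

  NonLosingPlay : Side → Play s x → Set ℓ
  NonLosingPlay K p = Winning K p ⊎ Draw p

-- LI, LII, RI and RII are given by the starting side s and the side K that
-- follows the strategy: LI is s = L , K = L; LII is s = R , K = L;
-- RI is s = R , K = R; RII is s = L , K = R.  The opponent of (s , K) is
-- thus (s , op K).

record FPlay (s K : Side) (x : Hypergame ℓ) : Set (suc ℓ) where
  field
    moves  : List (Hypergame ℓ)
    isPlay : IsPlay s x moves
    toMove : turn s moves ≡ K

open FPlay public

-- respects: the partial function depends on the play as a sequence of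
-- hypergames only, and so not on how these are presented.
record Strategy (s K : Side) (x : Hypergame ℓ) : Set (suc ℓ) where
  field
    answer   : FPlay s K x → Maybe (Hypergame ℓ)
    respects : ∀ π π′ → List.Pointwise _≋_ (moves π) (moves π′) →
               Maybe.Pointwise _≋_ (answer π) (answer π′)
    legal    : ∀ π x′ → answer π ≡ just x′ → IsPlay s x (moves π ∷ʳ x′)
    defined  : ∀ π x′ → IsPlay s x (moves π ∷ʳ x′) → ∃ λ y → answer π ≡ just y

open Strategy public

module _ {s : Side} {x : Hypergame ℓ} where

  Coherent : ∀ {K} → Strategy s K x → Play s x → Set (suc ℓ)
  Coherent {K} f p = (π : FPlay s K x) → moves π ⊏ p →
                     ∀ x′ → answer f π ≡ just x′ → moves π ∷ʳ x′ ⊑ p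

  -- p is f * f′, which is determined only up to _≋_ of its positions.
  record IsProduct {K} (f : Strategy s K x) (f′ : Strategy s (op K) x)
                   (p : Play s x) : Set (suc ℓ) where
    field
      coherent  : Coherent f p
      coherent′ : Coherent f′ p
      maximal   : ∀ q → Coherent f q → Coherent f′ q → p ≼ q → q ≼ p

  NonLosing : ∀ {K} → Strategy s K x → Set (suc ℓ)
  NonLosing {K} f = ∀ (f′ : Strategy s (op K) x) p → IsProduct f f′ p → NonLosingPlay K p

HasNonLosing : (s K : Side) → Hypergame ℓ → Set (suc ℓ)
HasNonLosing s K x = Σ (Strategy s K x) NonLosing

data Player : Set where
  L R I II : Player

HasNonLosingFor : Player → Hypergame ℓ → Set (suc ℓ)
HasNonLosingFor L  x = HasNonLosing L L x × HasNonLosing R L x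
HasNonLosingFor R  x = HasNonLosing R R x × HasNonLosing L R x
HasNonLosingFor I  x = HasNonLosing L L x × HasNonLosing R R x
HasNonLosingFor II x = HasNonLosing R L x × HasNonLosing L R x

infix 4 _⇕_ _≈_
_⇕_ : Rel (Hypergame ℓ) (suc ℓ)
x ⇕ y = ∀ P → HasNonLosingFor P x ⇔ HasNonLosingFor P y

data Context ℓ : Set (suc ℓ) where
  □    : Context ℓ
  _+ʳ_ : Context ℓ → Hypergame ℓ → Context ℓ
  _+ˡ_ : Hypergame ℓ → Context ℓ → Context ℓ

_[_] : Context ℓ → Hypergame ℓ → Hypergame ℓ
□        [ x ] = x
(C +ʳ z) [ x ] = C [ x ] + z
(z +ˡ C) [ x ] = z + C [ x ]

_≈_ : Rel (Hypergame ℓ) (suc ℓ)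
x ≈ y = ∀ C → C [ x ] ⇕ C [ y ]

{-# OPTIONS --safe #-}
module Submission where

-- A strategy is a function on whole plays, but whether K can avoid losing
-- depends on the current position alone: K can do so exactly when the
-- position belongs to a set in which K, when to move, has a move that stays
-- in the set, and which the opponent cannot leave either.  Infinite plays are
-- draws, so nothing has to make progress.  Going from a strategy to such a
-- set, one takes the ends of the plays in which the strategy is followed; it
-- is never without an answer there, since the opponent who replays that very
-- play would then win (nonLosing⇒safe).  Going back, one prefers the moves
-- into the set; the axiom of choice turns the preference into a strategy that
-- depends on the hypergames in a play only up to equality
-- (strategy-following, safe⇒nonLosing).
--
-- By associativity and commutativity of the sum every additive context is a
-- sum with a fixed hypergame.  If y is at least as good for K as x, then K
-- survives on y + z by imagining a play on x + z next to it, in which K is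
-- safe, and a play on the comparison of y with x, in which K wins
-- (safe-replace).  Replies that fall in x are made in the imagination only
-- and call for yet another reply; x being well-founded, this ends with a
-- move in y or z.
--
-- Conversely, the context □ + (- x) separates.  As second player on x - x the
-- mirror strategy is safe for either side, so an indistinguishable y makes
-- y - x safe for the second player too.  Since y - x is well-founded, safety
-- there can be unwound into the recursive definition of the order
-- (safe⇒atLeast), once for each side.

open import Axiom.ExcludedMiddle using (ExcludedMiddle)
open import Data.Empty using (⊥; ⊥-elim)
open import Data.List.Base using (List; []; _∷_; _∷ʳ_; applyUpTo; length; map)
open import Data.List.Relation.Binary.Pointwise as Pointwise using (Pointwise; []; _∷_)
open import Data.List.Relation.Binary.Prefix.Heterogeneous using (Prefix; []; _∷_; _++ᵖ_)
import Data.List.Relation.Binary.Prefix.Heterogeneous.Properties as Prefix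
open import Data.List.Reverse using (Reverse; []; _∶_∶ʳ_; reverseView)
open import Data.Maybe.Base using (Maybe; just; nothing)
import Data.Maybe.Relation.Binary.Pointwise as MaybeEq
open import Data.Nat.Base as ℕ using (ℕ; _≤_; z≤n; s≤s)
open import Data.Nat.Properties using (m≤m+n; m≤n+m)
open import Data.Product.Base using (∃; Σ; _×_; _,_; proj₁; proj₂; swap)
open import Data.Sum.Base using (_⊎_; inj₁; inj₂)
import Data.Unit.Polymorphic as Unit
open import Function.Base using (_∘_; id; case_of_)
open import Function.Bundles using (Func; _⇔_; mk⇔; Equivalence)
open import Induction.WellFounded using (Acc; acc)
open import Level using (Level; suc; Lift; lift; lower)
open import Relation.Binary.Bundles using (Setoid)
import Relation.Binary.Construct.On as On
open import Relation.Binary.Core using (REL)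
open import Relation.Binary.PropositionalEquality
  using (_≡_; _≢_; refl; sym; trans; cong; subst; subst₂)
open import Relation.Nullary.Decidable using (yes; no; map′)
open import Relation.Nullary.Negation using (¬_; contradiction)
open import Relation.Unary using (Pred)
open import Defs

private
  variable
    ℓ     : Level
    s K   : Side
    x y z : Hypergame ℓ
    π ρ τ : List (Hypergame ℓ)

-- Sides

op-involutive : ∀ K → op (op K) ≡ K
op-involutive L = refl
op-involutive R = refl

op≢ : ∀ K → op K ≢ K
op≢ L ()
op≢ R ()

same-or-op : ∀ K t → t ≡ K ⊎ t ≡ op K
same-or-op L L = inj₁ refl
same-or-op L R = inj₂ refl
same-or-op R L = inj₂ refl
same-or-op R R = inj₁ refl

-- Equality of hypergames

≋-refl : x ≋ x
≋-refl = _≡_ , record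
  { forth = λ { refl K a o → a , o , refl }
  ; back  = λ { refl K a o → a , o , refl }
  } , refl

≋-sym : x ≋ y → y ≋ x
≋-sym (Z , bisim , r) = (λ b a → Z a b) , record
  { forth = IsBisimulation.back bisim
  ; back  = IsBisimulation.forth bisim
  } , r

≋-trans : x ≋ y → y ≋ z → x ≋ z
≋-trans (Z , bisim , r) (Z′ , bisim′ , r′) =
  (λ a c → ∃ λ b → Z a b × Z′ b c) , record
  { forth = λ { (b , ab , bc) K a′ o →
      let b′ , o′ , ab′ = IsBisimulation.forth bisim ab K a′ o
          c′ , o″ , bc′ = IsBisimulation.forth bisim′ bc K b′ o′
      in  c′ , o″ , b′ , ab′ , bc′ }
  ; back  = λ { (b , ab , bc) K c′ o →
      let b′ , o′ , bc′ = IsBisimulation.back bisim′ bc K c′ o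
          a′ , o″ , ab′ = IsBisimulation.back bisim ab K b′ o′
      in  a′ , o″ , b′ , ab′ , bc′ }
  } , _ , r , r′

≋-setoid : ∀ ℓ → Setoid (suc ℓ) (suc ℓ)
≋-setoid ℓ = record
  { Carrier       = Hypergame ℓ
  ; _≈_           = _≋_
  ; isEquivalence = record { refl = ≋-refl ; sym = ≋-sym ; trans = ≋-trans }
  }

-- A bisimulation does not mention roots, so it serves for every pair in it.
related-nodes : ∀ {x y : Hypergame ℓ} {Z : REL (Node x) (Node y) ℓ} → IsBisimulation x y Z →
                ∀ {a b} → Z a b → x at a ≋ y at b
related-nodes {Z = Z} bisim ab = Z , record
  { forth = IsBisimulation.forth bisim
  ; back  = IsBisimulation.back bisim
  } , ab

∈-resp-≋ : ∀ {x x′ y y′ : Hypergame ℓ} → x ≋ x′ → y ≋ y′ → y ∈[ K ] x → y′ ∈[ K ] x′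
∈-resp-≋ {K = K} (Z , bisim , r) y≋y′ (a , o , a≋y) =
  let a′ , o′ , r′ = IsBisimulation.forth bisim r K a o
  in  a′ , o′ , ≋-trans (≋-sym (related-nodes bisim r′)) (≋-trans a≋y y≋y′)

-- Prefixes of plays

≋*-setoid : ∀ ℓ → Setoid (suc ℓ) (suc ℓ)
≋*-setoid ℓ = Pointwise.setoid (≋-setoid ℓ)

prefix-refl : Prefix _≋_ π π
prefix-refl {π = []}    = []
prefix-refl {π = _ ∷ _} = ≋-refl ∷ prefix-refl

prefix-trans : Prefix _≋_ π ρ → Prefix _≋_ ρ τ → Prefix _≋_ π τ
prefix-trans = Prefix.trans ≋-trans

prefix-init : ∀ π → Prefix _≋_ (π ∷ʳ y) τ → Prefix _≋_ π τ
prefix-init π = prefix-trans (prefix-refl ++ᵖ _)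

prefix-last : ∀ π → Prefix _≋_ (π ∷ʳ y) τ → Prefix _≋_ (π ∷ʳ z) τ → y ≋ z
prefix-last []      (e ∷ _)  (e′ ∷ _)  = ≋-trans e (≋-sym e′)
prefix-last (_ ∷ π) (_ ∷ es) (_ ∷ es′) = prefix-last π es es′

∷ʳ-not-prefix : ∀ π → ¬ Prefix _≋_ (π ∷ʳ y) π
∷ʳ-not-prefix []      ()
∷ʳ-not-prefix (_ ∷ π) (_ ∷ es) = ∷ʳ-not-prefix π es

prefix-of-∷ʳ : ∀ ρ π → Prefix _≋_ (ρ ∷ʳ z) (π ∷ʳ y) →
               Prefix _≋_ (ρ ∷ʳ z) π ⊎ Pointwise _≋_ ρ π
prefix-of-∷ʳ []          []      _        = inj₂ []
prefix-of-∷ʳ []          (_ ∷ π) (e ∷ _)  = inj₁ (e ∷ [])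
prefix-of-∷ʳ (_ ∷ [])    []      (_ ∷ ())
prefix-of-∷ʳ (_ ∷ _ ∷ _) []      (_ ∷ ())
prefix-of-∷ʳ (_ ∷ ρ)     (_ ∷ π) (e ∷ es) with prefix-of-∷ʳ ρ π es
... | inj₁ es′ = inj₁ (e ∷ es′)
... | inj₂ es′ = inj₂ (e ∷ es′)

-- Up to equality of positions, the prefixes of a play form a chain.
prefixes-comparable : Prefix _≋_ π τ → Prefix _≋_ ρ τ →
                      Prefix _≋_ ρ π ⊎ ∃ λ y → Prefix _≋_ (π ∷ʳ y) ρ
prefixes-comparable _        []         = inj₁ []
prefixes-comparable []       (_ ∷ _)    = inj₂ (_ , ≋-refl ∷ [])
prefixes-comparable (e ∷ es) (e′ ∷ es′) with prefixes-comparable es es′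
... | inj₁ es″       = inj₁ (≋-trans e′ (≋-sym e) ∷ es″)
... | inj₂ (y , es″) = inj₂ (y , ≋-trans e (≋-sym e′) ∷ es″)

applyUpTo-prefix : ∀ (σ : ℕ → Hypergame ℓ) {m n} → m ≤ n →
                   Prefix _≋_ (applyUpTo σ m) (applyUpTo σ n)
applyUpTo-prefix σ z≤n       = []
applyUpTo-prefix σ (s≤s m≤n) = ≋-refl ∷ applyUpTo-prefix (σ ∘ ℕ.suc) m≤n

-- Plays

turn-∷ʳ : ∀ s (π : List (Hypergame ℓ)) → turn s (π ∷ʳ y) ≡ op (turn s π)
turn-∷ʳ s []      = refl
turn-∷ʳ s (_ ∷ π) = turn-∷ʳ (op s) π

end-∷ʳ : ∀ (π : List (Hypergame ℓ)) → end x (π ∷ʳ y) ≡ y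
end-∷ʳ []      = refl
end-∷ʳ (_ ∷ π) = end-∷ʳ π

turn-cong : Pointwise _≋_ π ρ → turn s π ≡ turn s ρ
turn-cong []       = refl
turn-cong (_ ∷ es) = turn-cong es

play-∷ʳ⁺ : IsPlay s x π → y ∈[ turn s π ] end x π → IsPlay s x (π ∷ʳ y)
play-∷ʳ⁺ []       o = o ∷ []
play-∷ʳ⁺ (m ∷ ms) o = m ∷ play-∷ʳ⁺ ms o

play-∷ʳ⁻ : ∀ π → IsPlay s x (π ∷ʳ y) → IsPlay s x π × y ∈[ turn s π ] end x π
play-∷ʳ⁻ []      (m ∷ _)  = [] , m
play-∷ʳ⁻ (_ ∷ π) (m ∷ ms) = let ms′ , o = play-∷ʳ⁻ π ms in m ∷ ms′ , o

play-prefix : x ≋ y → Prefix _≋_ π τ → IsPlay s y τ → IsPlay s x π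
play-prefix e []        _        = []
play-prefix e (e′ ∷ es) (m ∷ ms) =
  ∈-resp-≋ (≋-sym e) (≋-sym e′) m ∷ play-prefix e′ es ms

-- A node of x stands for every position of x only up to equality; histories
-- of nodes are nevertheless enough to reach every play, and unlike plays they
-- form a set of level ℓ.
history : ∀ {x y : Hypergame ℓ} {a π} → IsPlay s y π → x at a ≋ y →
          ∃ λ h → Pointwise _≋_ (map (x at_) h) π
history         []       e = [] , []
history {x = x} (m ∷ ms) e =
  let a′ , _ , e′ = ∈-resp-≋ (≋-sym e) ≋-refl m
      h , es      = history {x = x} ms e′
  in  a′ ∷ h , e′ ∷ es

-- Two prefixes of a possibly infinite play lie in a common finite play.
⊑-directed : (p : Play s x) → π ⊑ p → ρ ⊑ p →
             ∃ λ τ → IsPlay s x τ × Prefix _≋_ π τ × Prefix _≋_ ρ τ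
⊑-directed (finite τ play) es es′ = τ , play , es , es′
⊑-directed {π = π} {ρ = ρ} (infinite σ plays) es es′ =
  applyUpTo σ (length π ℕ.+ length ρ) , plays _ ,
  prefix-trans es (applyUpTo-prefix σ (m≤m+n (length π) (length ρ))) ,
  prefix-trans es′ (applyUpTo-prefix σ (m≤n+m (length ρ) (length π)))

-- Coherence and products of strategies

module _ {s : Side} {x : Hypergame ℓ} where

  -- Coherent f on a finite play, as a property of the mere list of positions.
  Follows : Strategy s K x → List (Hypergame ℓ) → Set (suc ℓ)
  Follows {K} f π = (ρ : FPlay s K x) → (∃ λ y → Prefix _≋_ (moves ρ ∷ʳ y) π) →
                    ∀ y → answer f ρ ≡ just y → Prefix _≋_ (moves ρ ∷ʳ y) π

  -- A further move y adds a single requirement: wherever the strategy answers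
  -- a presentation of π itself, that answer is y.
  follows-∷ʳ : (f : Strategy s K x) → Follows f π →
                (∀ ρ → Pointwise _≋_ (moves ρ) π →
                 ∀ x′ → answer f ρ ≡ just x′ → x′ ≋ y) →
                Follows f (π ∷ʳ y)
  follows-∷ʳ {π = π} f coh last ρ (z , es) x′ eq with prefix-of-∷ʳ (moves ρ) π es
  ... | inj₁ es′ = coh ρ (z , es′) x′ eq ++ᵖ _
  ... | inj₂ es′ = Prefix.++⁺ es′ (last ρ es′ x′ eq ∷ [])

  follows-own-move : (f : Strategy s K x) (π : FPlay s K x) →
                      Follows f (moves π) → answer f π ≡ just y →
                      Follows f (moves π ∷ʳ y)
  follows-own-move {y = y} f π coh eq = follows-∷ʳ f coh same
    where
    same : ∀ ρ → Pointwise _≋_ (moves ρ) (moves π) →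
           ∀ x′ → answer f ρ ≡ just x′ → x′ ≋ y
    same ρ es x′ eq′ =
      MaybeEq.drop-just (subst₂ (MaybeEq.Pointwise _≋_) eq′ eq (respects f ρ π es))

  follows-other-move : (f : Strategy s K x) → Follows f π → turn s π ≢ K →
                        Follows f (π ∷ʳ y)
  follows-other-move f coh turn≢K = follows-∷ʳ f coh λ ρ es _ _ →
    contradiction (trans (sym (turn-cong es)) (toMove ρ)) turn≢K

  -- If a move were left, the strategy of the player to move would make one,
  -- and the longer play would contradict maximality.
  product-is-over : (f : Strategy s K x) (f′ : Strategy s (op K) x) {play : IsPlay s x π} →
                    IsProduct f f′ (finite π play) → ¬ ∃ λ y → IsPlay s x (π ∷ʳ y)
  product-is-over {K = K} {π = π} f f′ {play} prod (y , play⁺) with same-or-op K (turn s π)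
  ... | inj₁ eq =
    let π′        = record { moves = π ; isPlay = play ; toMove = eq }
        y′ , answ = defined f π′ y play⁺
        play′     = legal f π′ y′ answ
        longer    = finite (π ∷ʳ y′) play′
    in ∷ʳ-not-prefix π (IsProduct.maximal prod longer
         (follows-own-move f π′ (IsProduct.coherent prod) answ)
         (follows-other-move f′ (IsProduct.coherent′ prod)
           λ eq′ → op≢ K (trans (sym eq′) eq))
         (λ _ es → es ++ᵖ _) (π ∷ʳ y′) prefix-refl)
  ... | inj₂ eq =
    let π′        = record { moves = π ; isPlay = play ; toMove = eq }
        y′ , answ = defined f′ π′ y play⁺
        play′     = legal f′ π′ y′ answ
        longer    = finite (π ∷ʳ y′) play′
    in ∷ʳ-not-prefix π (IsProduct.maximal prod longer
         (follows-other-move f (IsProduct.coherent prod)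
           λ eq′ → op≢ K (trans (sym eq) eq′))
         (follows-own-move f′ π′ (IsProduct.coherent′ prod) answ)
         (λ _ es → es ++ᵖ _) (π ∷ʳ y′) prefix-refl)

  -- A prefix of a longer play is comparable with the finished play, and cannot
  -- properly extend it.
  over-is-product : (f : Strategy s K x) (f′ : Strategy s (op K) x) (play : IsPlay s x π) →
                    Follows f π → Follows f′ π →
                    ¬ (∃ λ y → IsPlay s x (π ∷ʳ y)) →
                    IsProduct f f′ (finite π play)
  over-is-product {π = π} f f′ play coh coh′ over = record
    { coherent  = coh
    ; coherent′ = coh′
    ; maximal   = maximal
    }
    where
    maximal : ∀ q → Coherent f q → Coherent f′ q → finite π play ≼ q → q ≼ finite π play
    maximal q _ _ p≼q ρ ρ⊑q
      with τ , playτ , es , es′ ← ⊑-directed {π = π} {ρ = ρ} q (p≼q π prefix-refl) ρ⊑q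
      with prefixes-comparable es es′
    ... | inj₁ es″       = es″
    ... | inj₂ (y , es″) =
      contradiction (y , play-prefix ≋-refl (prefix-trans es″ es′) playτ) over

-- Strategies from preferences

-- Every preference among moves that respects equality is followed by some
-- strategy.  The axiom of choice picks, for each history of nodes, a node
-- that stands for a legal and if possible preferred move.
module _ (em : ExcludedMiddle (suc ℓ)) (choice : AxiomOfChoice ℓ) (s K : Side) (x : Hypergame ℓ)
         (Prefers : REL (List (Hypergame ℓ)) (Hypergame ℓ) (suc ℓ))
         (prefers-resp : ∀ {π ρ y z} → Pointwise _≋_ π ρ → y ≋ z →
                         Prefers π y → Prefers ρ z) where

  private
    Legal : REL (List (Hypergame ℓ)) (Hypergame ℓ) (suc ℓ)
    Legal π y = IsPlay s x (π ∷ʳ y)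

    legal-resp : ∀ {π ρ y z} → Pointwise _≋_ π ρ → y ≋ z → Legal π y → Legal ρ z
    legal-resp es e = play-prefix ≋-refl
      (Prefix.++⁺ (Setoid.sym (≋*-setoid ℓ) es) (≋-sym e ∷ []))

    -- Stated so that it is void where no legal move is preferred.
    Obeys : REL (List (Hypergame ℓ)) (Hypergame ℓ) (suc ℓ)
    Obeys π y = (∃ λ z → Legal π z × Prefers π z) → Prefers π y

    obeys-resp : ∀ {π ρ y z} → Pointwise _≋_ π ρ → y ≋ z → Obeys π y → Obeys ρ z
    obeys-resp es e obeys (w , l , pr) = prefers-resp es e
      (obeys (w , legal-resp es⁻¹ ≋-refl l , prefers-resp es⁻¹ ≋-refl pr))
      where es⁻¹ = Setoid.sym (≋*-setoid ℓ) es

    -- The second case makes the relation total at the ends of plays; the node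
    -- chosen there is ignored.
    Good : REL (List (Hypergame ℓ)) (Hypergame ℓ) (suc ℓ)
    Good π y = (Legal π y × Obeys π y) ⊎ ¬ ∃ (Legal π)

    good-resp : ∀ {π ρ y z} → Pointwise _≋_ π ρ → y ≋ z → Good π y → Good ρ z
    good-resp es e (inj₁ (l , obeys)) = inj₁ (legal-resp es e l , obeys-resp es e obeys)
    good-resp es e (inj₂ none)        = inj₂ λ (w , l) →
      none (w , legal-resp (Setoid.sym (≋*-setoid ℓ) es) ≋-refl l)

    nodes histories : Setoid ℓ (suc ℓ)
    nodes     = On.setoid (≋-setoid ℓ) (x at_)
    histories = On.setoid (≋*-setoid ℓ) (map (x at_))

    legal-node : ∀ {π y} → Legal π y → ∃ λ a → x at a ≋ y
    legal-node {π} l = last π (proj₂ (history {x = x} l ≋-refl))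
      where
      last : ∀ π {h y} → Pointwise _≋_ (map (x at_) h) (π ∷ʳ y) → ∃ λ a → x at a ≋ y
      last []      {_ ∷ _} (e ∷ _)  = _ , e
      last (_ ∷ π) {_ ∷ _} (_ ∷ es) = last π es

    good-total : ∀ h → ∃ λ a → Good (map (x at_) h) (x at a)
    good-total h with em {∃ λ z → Legal (map (x at_) h) z × Prefers (map (x at_) h) z}
    ... | yes (z , l , pr) =
      let a , e = legal-node l
          refl* = Setoid.refl (≋*-setoid ℓ)
      in  a , inj₁ (legal-resp refl* (≋-sym e) l , λ _ → prefers-resp refl* (≋-sym e) pr)
    ... | no ¬pr with em {∃ (Legal (map (x at_) h))}
    ...   | yes (z , l) =
      let a , e = legal-node l
      in  a , inj₁ ( legal-resp (Setoid.refl (≋*-setoid ℓ)) (≋-sym e) l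
                   , λ pr → contradiction pr ¬pr )
    ...   | no none = root x , inj₂ none

    chosen : Σ (Func histories nodes) λ g → ∀ h → Good (map (x at_) h) (x at Func.to g h)
    chosen = choice histories nodes (λ h a → Good (map (x at_) h) (x at a))
      (λ es → good-resp es ≋-refl) (λ e → good-resp (Setoid.refl (≋*-setoid ℓ)) e) good-total

    move : FPlay s K x → Hypergame ℓ
    move π = x at Func.to (proj₁ chosen) (proj₁ (history {x = x} (isPlay π) ≋-refl))

    good-move : ∀ π → Good (moves π) (move π)
    good-move π = let h , es = history {x = x} (isPlay π) ≋-refl in
      good-resp es ≋-refl (proj₂ chosen h)

    move-cong : ∀ π ρ → Pointwise _≋_ (moves π) (moves ρ) → move π ≋ move ρ
    move-cong π ρ es =
      let h  , eh  = history {x = x} (isPlay π) ≋-refl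
          h′ , eh′ = history {x = x} (isPlay ρ) ≋-refl
          module ≋* = Setoid (≋*-setoid ℓ)
      in  Func.cong (proj₁ chosen) {h} {h′} (≋*.trans eh (≋*.trans es (≋*.sym eh′)))

    move-if-legal : ∀ {π y} → Good π y → Maybe (Hypergame ℓ)
    move-if-legal {y = y} (inj₁ _) = just y
    move-if-legal         (inj₂ _) = nothing

    strategy : Strategy s K x
    strategy = record
      { answer   = λ π → move-if-legal (good-move π)
      ; respects = λ π ρ es → cong-good es (move-cong π ρ es) (good-move π) (good-move ρ)
      ; legal    = λ π y → good⇒legal (good-move π)
      ; defined  = λ π y l → good⇒defined (good-move π) l
      }
      where
      cong-good : ∀ {π ρ y z} → Pointwise _≋_ π ρ → y ≋ z →
                  (g : Good π y) (g′ : Good ρ z) →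
                  MaybeEq.Pointwise _≋_ (move-if-legal g) (move-if-legal g′)
      cong-good es e (inj₁ _)       (inj₁ _)       = MaybeEq.just e
      cong-good es e (inj₁ (l , _)) (inj₂ none)    = contradiction (_ , legal-resp es e l) none
      cong-good es e (inj₂ none)    (inj₁ (l , _)) = contradiction
        (_ , legal-resp (Setoid.sym (≋*-setoid ℓ) es) (≋-sym e) l) none
      cong-good es e (inj₂ _)       (inj₂ _)       = MaybeEq.nothing

      good⇒legal : ∀ {π y z} (g : Good π y) → move-if-legal g ≡ just z → Legal π z
      good⇒legal (inj₁ (l , _)) refl = l

      good⇒defined : ∀ {π y z} (g : Good π y) → Legal π z → ∃ λ w → move-if-legal g ≡ just w
      good⇒defined (inj₁ _)    l = _ , refl
      good⇒defined (inj₂ none) l = contradiction (_ , l) none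

  strategy-following : Σ (Strategy s K x) λ f → ∀ π y → answer f π ≡ just y →
                       (∃ λ z → IsPlay s x (moves π ∷ʳ z) × Prefers (moves π) z) →
                       Prefers (moves π) y
  strategy-following = strategy , λ π y → good⇒obeys (good-move π)
    where
    good⇒obeys : ∀ {π y z} (g : Good π y) → move-if-legal g ≡ just z → Obeys π z
    good⇒obeys (inj₁ (_ , obeys)) refl = obeys

-- Non-losing sets

-- A post-fixed point of the operator whose greatest fixed point consists of
-- the positions, indexed by the side to move, where K can avoid losing.  The
-- values of J lie one level up so that J may speak of plays.
record IsNonLosingSet (K : Side) (x : Hypergame ℓ) (J : Side → Pred (Node x) (suc ℓ)) :
                      Set (suc ℓ) where
  field
    reply  : ∀ {a} → J K a → ∃ λ a′ → Options x K a a′ × J (op K) a′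
    endure : ∀ {a} → J (op K) a → ∀ a′ → Options x (op K) a a′ → J K a′

open IsNonLosingSet

Safe : (s K : Side) → Hypergame ℓ → Set (suc (suc ℓ))
Safe s K x = ∃ λ J → IsNonLosingSet K x J × J s (root x)

safe-resp-≋ : x ≋ y → Safe s K x → Safe s K y
safe-resp-≋ {K = K} (Z , bisim , r) (J , closed , j) =
  (λ t b → ∃ λ a → Z a b × J t a) , record
  { reply  = λ (a , ab , ja) →
      let a′ , o , ja′  = reply closed ja
          b′ , o′ , ab′ = IsBisimulation.forth bisim ab K a′ o
      in  b′ , o′ , a′ , ab′ , ja′
  ; endure = λ (a , ab , ja) b′ o →
      let a′ , o′ , ab′ = IsBisimulation.back bisim ab (op K) b′ o
      in  a′ , ab′ , endure closed ja a′ o′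
  } , _ , r , j

module _ (em : ExcludedMiddle (suc ℓ)) (choice : AxiomOfChoice ℓ) {s K : Side} {x : Hypergame ℓ}
  where

  -- K prefers the moves into J.  Plays coherent with the resulting strategy
  -- stay in J, where K always has a move, so a maximal finite play can only
  -- end with the opponent to move.
  safe⇒nonLosing : Safe s K x → HasNonLosing s K x
  safe⇒nonLosing (J , closed , j) = f , nonLosing
    where
    -- The closure of J under equality: the positions of a play need not be
    -- presented by nodes of x.
    J̄ : Side → Hypergame ℓ → Set (suc ℓ)
    J̄ t w = ∃ λ a → x at a ≋ w × J t a

    J̄-resp : ∀ {t w w′} → w ≋ w′ → J̄ t w → J̄ t w′
    J̄-resp e (a , e′ , ja) = a , ≋-trans e′ e , ja

    J̄-reply : ∀ {w} → J̄ K w → ∃ λ w′ → w′ ∈[ K ] w × J̄ (op K) w′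
    J̄-reply (a , e , ja) = let a′ , o , ja′ = reply closed ja in
      x at a′ , ∈-resp-≋ e ≋-refl (a′ , o , ≋-refl) , a′ , ≋-refl , ja′

    J̄-endure : ∀ {w w′} → J̄ (op K) w → w′ ∈[ op K ] w → J̄ K w′
    J̄-endure (a , e , ja) m = let a′ , o , e′ = ∈-resp-≋ (≋-sym e) ≋-refl m in
      a′ , e′ , endure closed ja a′ o

    following = strategy-following em choice s K x (λ _ → J̄ (op K)) (λ _ → J̄-resp)

    f : Strategy s K x
    f = proj₁ following

    -- When K moved last, coherence makes the actual move equal to the answer
    -- of f, which follows the preference.
    stays : ∀ {π} → IsPlay s x π → Follows f π →
            ∀ {ρ} → Reverse ρ → Prefix _≋_ ρ π → J̄ (turn s ρ) (end x ρ)
    stays play coh [] _ = root x , ≋-refl , j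
    stays play coh (ρ ∶ rs ∶ʳ y) es
      rewrite turn-∷ʳ {y = y} s ρ | end-∷ʳ {x = x} {y = y} ρ
      with stays play coh rs (prefix-init ρ es)
         | play-∷ʳ⁻ ρ (play-prefix ≋-refl es play)
         | same-or-op K (turn s ρ)
    ... | jρ | playρ , m | inj₂ eq rewrite eq =
      subst (λ t → J̄ t y) (sym (op-involutive K)) (J̄-endure jρ m)
    ... | jρ | playρ , m | inj₁ eq =
      let w , m′ , jw = J̄-reply (subst (λ t → J̄ t (end x ρ)) eq jρ)
          ρ′          = record { moves = ρ ; isPlay = playρ ; toMove = eq }
          playw       = play-∷ʳ⁺ playρ (subst (λ t → w ∈[ t ] end x ρ) (sym eq) m′)
          y′ , answ   = defined f ρ′ w playw
          jy′         = proj₂ following ρ′ y′ answ (w , playw , jw)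
      in  subst (λ t → J̄ (op t) y) (sym eq)
            (J̄-resp (prefix-last ρ (coh ρ′ (y , es) y′ answ) es) jy′)

    nonLosing : NonLosing f
    nonLosing f′ (infinite _ _)    prod = inj₂ _
    nonLosing f′ (finite π play) prod with same-or-op K (turn s π)
    ... | inj₁ eq =
      let jπ         = stays play (IsProduct.coherent prod) (reverseView π) prefix-refl
          w , m , jw = J̄-reply (subst (λ t → J̄ t (end x π)) eq jπ)
      in  contradiction (w , play-∷ʳ⁺ play (subst (λ t → w ∈[ t ] end x π) (sym eq) m))
                        (product-is-over f f′ prod)
    ... | inj₂ eq = inj₁ (eq , λ a o → product-is-over f f′ prod
      (end x π at a , play-∷ʳ⁺ play
        (a , subst (λ t → Options (end x π) t (root (end x π)) a) (sym eq) o , ≋-refl)))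

  -- The ends of the finite plays coherent with the strategy form the set.
  nonLosing⇒safe : HasNonLosing s K x → Safe s K x
  nonLosing⇒safe (f , nonLosing) = J , record { reply = J-reply ; endure = J-endure } , start
    where
    J : Side → Pred (Node x) (suc ℓ)
    J t a = ∃ λ π → Σ (IsPlay s x π) λ play →
            Follows f π × turn s π ≡ t × x at a ≋ end x π

    start : J s (root x)
    start = [] , [] ,
      (λ ρ (_ , es) → contradiction (prefix-trans es []) (∷ʳ-not-prefix (moves ρ))) ,
      refl , ≋-refl

    J-endure : ∀ {a} → J (op K) a → ∀ a′ → Options x (op K) a a′ → J K a′
    J-endure (π , play , coh , eq , e) a′ o =
      π ∷ʳ (x at a′) , play′ ,
      follows-other-move f coh (λ eq′ → op≢ K (trans (sym eq) eq′)) ,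
      trans (turn-∷ʳ s π) (trans (cong op eq) (op-involutive K)) ,
      subst (x at a′ ≋_) (sym (end-∷ʳ π)) ≋-refl
      where
      play′ : IsPlay s x (π ∷ʳ (x at a′))
      play′ = play-∷ʳ⁺ play (∈-resp-≋ e ≋-refl
        (a′ , subst (λ t → Options x t _ a′) (sym eq) o , ≋-refl))

    -- The opponent whose preference is to replay π makes π the product, and K
    -- would be to move at its end.
    not-stuck : (π : FPlay s K x) → Follows f (moves π) →
                  ¬ ¬ (∃ λ y → IsPlay s x (moves π ∷ʳ y))
    not-stuck π coh over
      with f′ , follows ← strategy-following em choice s (op K) x
                            (λ ρ y → Prefix _≋_ (ρ ∷ʳ y) (moves π))
                            (λ es e → prefix-trans (Prefix.++⁺
                              (Setoid.sym (≋*-setoid ℓ) es) (≋-sym e ∷ [])))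
      with nonLosing f′ (finite (moves π) (isPlay π))
             (over-is-product f f′ (isPlay π) coh
               (λ ρ (z , es) y answ →
                 follows ρ y answ (z , play-prefix ≋-refl es (isPlay π) , es))
               over)
    ... | inj₁ (eq , _) = op≢ K (trans (sym eq) (toMove π))

    J-reply : ∀ {a} → J K a → ∃ λ a′ → Options x K a a′ × J (op K) a′
    J-reply (π , play , coh , eq , e) = go (answer f π′) refl
      where
      π′ : FPlay s K x
      π′ = record { moves = π ; isPlay = play ; toMove = eq }

      go : ∀ m → answer f π′ ≡ m → ∃ λ a′ → Options x K _ a′ × J (op K) a′
      go nothing  answ = ⊥-elim (not-stuck π′ coh λ (y , play⁺) →
        case trans (sym answ) (proj₂ (defined f π′ y play⁺)) of λ ())
      go (just y) answ =
        let play′       = legal f π′ y answ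
            _ , m       = play-∷ʳ⁻ π play′
            a′ , o , e′ = ∈-resp-≋ (≋-sym e) ≋-refl m
        in  a′ , subst (λ t → Options x t _ a′) eq o ,
            π ∷ʳ y , play′ , follows-own-move f π′ coh answ ,
            trans (turn-∷ʳ s π) (cong op eq) ,
            subst (x at a′ ≋_) (sym (end-∷ʳ π)) e′

-- Contexts

0ᴳ : Hypergame ℓ
0ᴳ = record { Node = Unit.⊤ ; Options = λ _ _ _ → Lift _ ⊥ ; root = _ }

+-identityʳ : (x : Hypergame ℓ) → x + 0ᴳ ≋ x
+-identityʳ x = (λ (a , _) b → a ≡ b) , record
  { forth = λ { refl K (a′ , _) (inj₁ (o , _)) → a′ , o , refl
              ; refl K (a′ , _) (inj₂ (_ , lift ())) }
  ; back  = λ { refl K a′ o → (a′ , _) , inj₁ (o , refl) , refl }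
  } , refl

+-assoc : (x y z : Hypergame ℓ) → (x + y) + z ≋ x + (y + z)
+-assoc x y z = (λ ((a , b) , c) d → (a , b , c) ≡ d) , record
  { forth = λ { refl K _ (inj₁ (inj₁ (o , refl) , refl)) → _ , inj₁ (o , refl) , refl
              ; refl K _ (inj₁ (inj₂ (refl , o) , refl)) → _ , inj₂ (refl , inj₁ (o , refl)) , refl
              ; refl K _ (inj₂ (refl , o)) → _ , inj₂ (refl , inj₂ (refl , o)) , refl }
  ; back  = λ { refl K _ (inj₁ (o , refl)) → _ , inj₁ (inj₁ (o , refl) , refl) , refl
              ; refl K _ (inj₂ (refl , inj₁ (o , refl))) → _ , inj₁ (inj₂ (refl , o) , refl) , refl
              ; refl K _ (inj₂ (refl , inj₂ (refl , o))) → _ , inj₂ (refl , o) , refl }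
  } , refl

+-comm : (x y : Hypergame ℓ) → x + y ≋ y + x
+-comm x y = (λ a b → swap a ≡ b) , record
  { forth = λ { refl K _ (inj₁ (o , refl)) → _ , inj₂ (refl , o) , refl
              ; refl K _ (inj₂ (refl , o)) → _ , inj₁ (o , refl) , refl }
  ; back  = λ { refl K _ (inj₁ (o , refl)) → _ , inj₂ (refl , o) , refl
              ; refl K _ (inj₂ (refl , o)) → _ , inj₁ (o , refl) , refl }
  } , refl

+-congʳ : ∀ {x y : Hypergame ℓ} z → x ≋ y → x + z ≋ y + z
+-congʳ z (Z , bisim , r) = (λ (a , c) (b , d) → Z a b × c ≡ d) , record
  { forth = λ { (ab , refl) K _ (inj₁ (o , refl)) →
                  let b′ , o′ , ab′ = IsBisimulation.forth bisim ab K _ o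
                  in  _ , inj₁ (o′ , refl) , ab′ , refl
              ; (ab , refl) K _ (inj₂ (refl , o)) → _ , inj₂ (refl , o) , ab , refl }
  ; back  = λ { (ab , refl) K _ (inj₁ (o , refl)) →
                  let a′ , o′ , ab′ = IsBisimulation.back bisim ab K _ o
                  in  _ , inj₁ (o′ , refl) , ab′ , refl
              ; (ab , refl) K _ (inj₂ (refl , o)) → _ , inj₂ (refl , o) , ab , refl }
  } , r , refl

rest : Context ℓ → Hypergame ℓ
rest □        = 0ᴳ
rest (C +ʳ z) = rest C + z
rest (z +ˡ C) = rest C + z

context-is-sum : ∀ C (x : Hypergame ℓ) → C [ x ] ≋ x + rest C
context-is-sum □        x = ≋-sym (+-identityʳ x)
context-is-sum (C +ʳ z) x = ≋-trans (+-congʳ z (context-is-sum C x)) (+-assoc x (rest C) z)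
context-is-sum (z +ˡ C) x =
  ≋-trans (+-comm z (C [ x ]))
    (≋-trans (+-congʳ z (context-is-sum C x)) (+-assoc x (rest C) z))

-- Comparison of Conway games

-- How the comparison looks to K: R prefers the smaller game.
AtLeast : Side → (x y : Hypergame ℓ) {a : Node x} {b : Node y} →
          Acc (IsOption x) a → Acc (IsOption y) b → Set ℓ
AtLeast L x y p q = geq x y p q
AtLeast R x y p q = geq y x q p

-- Exchanging the sides turns geq around, so the recursion that defines geq
-- holds for either K in the role of Left; later arguments need no duality.
atLeast-unfold : ∀ K (x y : Hypergame ℓ) {a b}
  {p : ∀ {a′} → IsOption x a′ a → Acc (IsOption x) a′}
  {q : ∀ {b′} → IsOption y b′ b → Acc (IsOption y) b′} →
  AtLeast K x y (acc p) (acc q) ⇔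
  ((∀ a′ (o : Options x (op K) a a′) → ¬ AtLeast K y x (acc q) (p (op K , o))) ×
   (∀ b′ (o : Options y K b b′) → ¬ AtLeast K y x (q (K , o)) (acc p)))
atLeast-unfold L x y = mk⇔ id id
atLeast-unfold R x y = mk⇔ swap swap

-- Replacing a summand by a better one

module _ (em : ExcludedMiddle ℓ) (K : Side) (x y z : Hypergame ℓ)
         {J : Side → Pred (Node (x + z)) (suc ℓ)} (closed : IsNonLosingSet K (x + z) J) where

  private
    -- The positions (b , c) reached while K imagines a position (a , c) in J:
    -- either the same side is to move in both and b is at least as good as a,
    -- or K still has to answer in the comparison of b with a.
    data Shadowed (t : Side) : Pred (Node (y + z)) (suc ℓ) where
      level : ∀ {a b c} (p : Acc (IsOption x) a) (q : Acc (IsOption y) b) →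
              AtLeast K y x q p → J t (a , c) → Shadowed t (b , c)
      ahead : ∀ {a b c} (p : Acc (IsOption x) a) (q : Acc (IsOption y) b) → t ≡ K →
              ¬ AtLeast K x y p q → J (op K) (a , c) → Shadowed t (b , c)

    Reply : Node (y + z) → Set (suc ℓ)
    Reply d = ∃ λ d′ → Options (y + z) K d d′ × Shadowed (op K) d′

    -- A reply in x only changes the imagined position, and K then owes an
    -- answer in the comparison; an answer in x is met by the safe reply on
    -- x + z.  The two alternate down the well-founded x.
    reply-level : ∀ {a b c} (p : Acc (IsOption x) a) (q : Acc (IsOption y) b) →
                  AtLeast K y x q p → J K (a , c) → Reply (b , c)
    reply-ahead : ∀ {a b c} (p : Acc (IsOption x) a) (q : Acc (IsOption y) b) →
                  ¬ AtLeast K x y p q → J (op K) (a , c) → Reply (b , c)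

    reply-level (acc p) (acc q) y≥x j with reply closed j
    ... | (a′ , c) , inj₁ (o , refl) , j′ =
      reply-ahead (p (K , o)) (acc q) (proj₂ (Equivalence.to (atLeast-unfold K y x) y≥x) a′ o) j′
    ... | (a , c′) , inj₂ (refl , o) , j′ =
      (_ , c′) , inj₂ (refl , o) , level (acc p) (acc q) y≥x j′

    reply-ahead {a} {b} {c} (acc p) (acc q) x≱y j
      with em {∃ λ a′ → Σ (Options x (op K) a a′) λ o →
                        AtLeast K y x (acc q) (p (op K , o))}
    ... | yes (a′ , o , y≥x) =
      reply-level (p (op K , o)) (acc q) y≥x (endure closed j (a′ , c) (inj₁ (o , refl)))
    ... | no none
      with em {∃ λ b′ → Σ (Options y K b b′) λ o → AtLeast K y x (q (K , o)) (acc p)}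
    ...   | yes (b′ , o , y≥x) = (b′ , c) , inj₁ (o , refl) , level (acc p) (q (K , o)) y≥x j
    ...   | no none′ = contradiction
      (Equivalence.from (atLeast-unfold K x y)
        ((λ a′ o ge → none (a′ , o , ge)) , λ b′ o ge → none′ (b′ , o , ge)))
      x≱y

    shadowed-endure : ∀ {d} → Shadowed (op K) d → ∀ d′ → Options (y + z) (op K) d d′ →
                      Shadowed K d′
    shadowed-endure (ahead _ _ eq _ _) _ _ = contradiction eq (op≢ K)
    shadowed-endure (level (acc p) (acc q) y≥x j) (b′ , c) (inj₁ (o , refl)) =
      ahead (acc p) (q (op K , o)) refl (proj₁ (Equivalence.to (atLeast-unfold K y x) y≥x) b′ o) j
    shadowed-endure (level p q y≥x j) (b , c′) (inj₂ (refl , o)) =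
      level p q y≥x (endure closed j (_ , c′) (inj₂ (refl , o)))

    shadowed-reply : ∀ {d} → Shadowed K d → Reply d
    shadowed-reply (level p q y≥x j)   = reply-level p q y≥x j
    shadowed-reply (ahead p q _ x≱y j) = reply-ahead p q x≱y j

  safe-replace : (p : Acc (IsOption x) (root x)) (q : Acc (IsOption y) (root y)) →
                 AtLeast K y x q p → J s (root (x + z)) → Safe s K (y + z)
  safe-replace p q y≥x j =
    Shadowed , record { reply = shadowed-reply ; endure = shadowed-endure } , level p q y≥x j

-- Testing against the negative

neg : Hypergame ℓ → Hypergame ℓ
neg x = record { Node = Node x ; Options = Options x ∘ op ; root = root x }

-- The second player copies each move into the other summand.
mirror : ∀ K (x : Hypergame ℓ) → Safe (op K) K (x + neg x)
mirror {ℓ} K x =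
  Mirrored , record { reply = mirrored-reply ; endure = mirrored-endure } , balanced refl
  where
  data Mirrored (t : Side) : Pred (Node (x + neg x)) (suc ℓ) where
    balanced   : ∀ {a} → t ≡ op K → Mirrored t (a , a)
    answerable : ∀ {d a} → t ≡ K → Options (x + neg x) K d (a , a) → Mirrored t d

  mirrored-reply : ∀ {d} → Mirrored K d →
                   ∃ λ d′ → Options (x + neg x) K d d′ × Mirrored (op K) d′
  mirrored-reply (balanced eq)     = contradiction (sym eq) (op≢ K)
  mirrored-reply (answerable _ o)  = _ , o , balanced refl

  mirrored-endure : ∀ {d} → Mirrored (op K) d →
                    ∀ d′ → Options (x + neg x) (op K) d d′ → Mirrored K d′
  mirrored-endure (answerable eq _) _ _ = contradiction eq (op≢ K)
  mirrored-endure (balanced _) _ (inj₁ (o , refl)) = answerable refl (inj₂ (refl , o))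
  mirrored-endure (balanced _) _ (inj₂ (refl , o)) =
    answerable refl (inj₁ (subst (λ t → Options x t _ _) (op-involutive K) o , refl))

module _ (K : Side) (x y : Hypergame ℓ)
         {J : Side → Pred (Node (y + neg x)) (suc ℓ)} (closed : IsNonLosingSet K (y + neg x) J) where

  -- A safe reply refutes the comparison the other way round; well-foundedness
  -- of both games makes this an induction, so that safety means a win.
  safe⇒atLeast : ∀ {a b} (p : Acc (IsOption x) a) (q : Acc (IsOption y) b) →
                 J (op K) (b , a) → AtLeast K y x q p
  safe⇒notAtMost : ∀ {a b} (p : Acc (IsOption x) a) (q : Acc (IsOption y) b) →
                   J K (b , a) → ¬ AtLeast K x y p q

  safe⇒atLeast (acc p) (acc q) j = Equivalence.from (atLeast-unfold K y x)
    ( (λ b′ o → safe⇒notAtMost (acc p) (q (op K , o)) (endure closed j _ (inj₁ (o , refl))))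
    , (λ a′ o → safe⇒notAtMost (p (K , o)) (acc q) (endure closed j _
        (inj₂ (refl , subst (λ t → Options x t _ a′) (sym (op-involutive K)) o)))) )

  safe⇒notAtMost (acc p) (acc q) j x≥y
    with reply closed j | Equivalence.to (atLeast-unfold K x y) x≥y
  ... | (b′ , _) , inj₁ (o , refl) , j′ | _ , h = h b′ o (safe⇒atLeast (acc p) (q (K , o)) j′)
  ... | (_ , a′) , inj₂ (refl , o) , j′ | h , _ = h a′ o (safe⇒atLeast (p (op K , o)) (acc q) j′)

-- Contextual equivalence and the order

map-player : (∀ s K → HasNonLosing s K x → HasNonLosing s K y) →
             ∀ P → HasNonLosingFor P x → HasNonLosingFor P y
map-player f L  (u , v) = f L L u , f R L v
map-player f R  (u , v) = f R R u , f L R v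
map-player f I  (u , v) = f L L u , f R R v
map-player f II (u , v) = f R L u , f L R v

second-player : ∀ K → HasNonLosingFor II x → HasNonLosing (op K) K x
second-player L = proj₁
second-player R = proj₂

module _ (em : ExcludedMiddle (suc ℓ)) (choice : AxiomOfChoice ℓ) (x y : ConwayGame ℓ) where

  private
    X = hypergame x
    Y = hypergame y

  indistinguishable⇒atLeast : X ≈ Y → ∀ K → AtLeast K Y X (wellFounded y) (wellFounded x)
  indistinguishable⇒atLeast x≈y K =
    let test             = □ +ʳ neg X
        second-on-X      = safe⇒nonLosing em choice (mirror L X) ,
                           safe⇒nonLosing em choice (mirror R X)
        second-on-Y      = Equivalence.to (x≈y test II) second-on-X
        J , closed , j   = nonLosing⇒safe em choice (second-player {x = Y + neg X} K second-on-Y)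
    in  safe⇒atLeast K X Y closed (wellFounded x) (wellFounded y) j

  atLeast⇒nonLosing : (∀ K → AtLeast K Y X (wellFounded y) (wellFounded x)) →
                      ∀ C s K → HasNonLosing s K (C [ X ]) → HasNonLosing s K (C [ Y ])
  atLeast⇒nonLosing y≥x C s K u =
    let J , closed , j = safe-resp-≋ (context-is-sum C X) (nonLosing⇒safe em choice u)
    in  safe⇒nonLosing em choice (safe-resp-≋ (≋-sym (context-is-sum C Y))
          (safe-replace (map′ lower lift em) K X Y (rest C) closed
            (wellFounded x) (wellFounded y) (y≥x K) j))

theorem4p4 : ∀ {ℓ : Level} → ExcludedMiddle (suc ℓ) → AxiomOfChoice ℓ →
    (x y : ConwayGame ℓ) → (hypergame x ≈ hypergame y) ⇔ (x ∼ y)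
theorem4p4 em choice x y = mk⇔
  (λ x≈y → let y≥x = indistinguishable⇒atLeast em choice x y x≈y in y≥x R , y≥x L)
  (λ (x≳y , y≳x) C P → mk⇔
    (map-player (atLeast⇒nonLosing em choice x y (λ { L → y≳x ; R → x≳y }) C) P)
    (map-player (atLeast⇒nonLosing em choice y x (λ { L → x≳y ; R → y≳x }) C) P))
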